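{- Let $h_{n,d}=\sum_{|\alpha|=d}x_1^{\alpha_1}\cdots x_n^{\alpha_n}\in S^d\mathbb{C}^n$ be the complete symmetric polynomial of degree $d$ in $n$ variables. For every $n$, $d$, $e$ (with $0\le e\le d$), the flattening $$(h_{n,d})_{e,d-e}:S^e(\mathbb{C}^n)^*\to S^{d-e}\mathbb{C}^n,\qquad D\mapsto D(h_{n,d}),$$ has full rank, i.e. its rank equals $\min\{\dim S^e(\mathbb{C}^n)^*,\dim S^{d-e}\mathbb{C}^n\}$.
   Context: $S^d\mathbb{C}^n$ denotes the space of homogeneous polynomials of degree $d$ in $x_1,\dots,x_n$ over $\mathbb{C}$, and $S^e(\mathbb{C}^n)^*$ the space of homogeneous constant-coefficient differential operators of order $e$. The sum defining $h_{n,d}$ runs over all multi-indices $\alpha=(\alpha_1,\dots,\alpha_n)$ of nonnegative integers with $\alpha_1+\cdots+\alpha_n=d$. For $p\in S^d\mathbb{C}^n$ and $0\le e\le d$, the $e$-th flattening (partial derivative map) of $p$ is $p_{e,d-e}:D\mapsto D(p)$. -}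

module Defs where

open import Algebra.Apartness.Bundles using (HeytingField; module HeytingCommutativeRing)
open import Algebra.Bundles using (CommutativeRing)
open import Algebra.Module.Bundles using (Module)
open import Algebra.Module.Morphism.Structures using (IsModuleHomomorphism)
open import Algebra.Module.Structures.Biased using (IsModuleFromLeft)
import Algebra.Construct.Pointwise as Pointwise
import Algebra.Definitions.RawMonoid as RawMonoidDefs
import Algebra.Properties.CommutativeMonoid.Sum as Sum
import Algebra.Properties.Monoid.Mult as Mult
import Algebra.Properties.Ring as RingProperties
open import Data.Bool.Base using (if_then_else_)
open import Data.Empty using (⊥-elim)
open import Data.Fin.Base using (Fin; zero; suc)
open import Data.List.Base as List using (List; []; _∷_; length; upTo; allFin; concatMap)
open import Data.List.Membership.Propositional using (_∈_; find; lose)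
open import Data.List.Membership.Propositional.Properties as ∈
  using (∈-upTo⁺; ∈-upTo⁻; ∈-lookup)
import Data.List.Properties as List
open import Data.List.Relation.Unary.All as All using ([]; _∷_)
import Data.List.Relation.Unary.All.Properties as All
open import Data.List.Relation.Unary.AllPairs as AllPairs using ([]; _∷_)
import Data.List.Relation.Unary.AllPairs.Properties as AllPairs
open import Data.List.Relation.Binary.Disjoint.Propositional using (Disjoint)
open import Data.List.Relation.Unary.Any using (here)
open import Data.List.Relation.Unary.Unique.Propositional using (Unique)
import Data.List.Relation.Unary.Unique.Propositional.Properties as Unique
open import Data.Nat.Base using (ℕ; zero; suc; pred; _+_; _∸_; s≤s; s≤s⁻¹)
open import Data.Nat.GeneralisedArithmetic using (fold)
open import Data.Nat.Properties as ℕ using (_≟_)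
open import Data.Product.Base using (∃; _,_; proj₁)
open import Data.Vec.Base as Vec using (Vec; []; _∷_; lookup; _[_]%=_)
open import Data.Vec.Functional using (Vector)
import Data.Vec.Properties as Vec
open import Function.Base using (_∘_; id)
open import Level using (_⊔_)
open import Relation.Binary.PropositionalEquality as ≡ using (_≡_; _≢_)
open import Relation.Nullary.Decidable using (yes; no; does)

module LinearAlgebra {r ℓr} (R : CommutativeRing r ℓr) where

  private
    module R = CommutativeRing R

  module _ {m ℓm} (M : Module R m ℓm) where
    open Module M
    open Sum +ᴹ-commutativeMonoid using (sum)

    linearCombination : ∀ {k} → Vector R.Carrier k → Vector Carrierᴹ k → Carrierᴹ
    linearCombination c v = sum (λ i → c i *ₗ v i)

    LinearlyIndependent : ∀ {k} → Vector Carrierᴹ k → Set (r ⊔ ℓr ⊔ ℓm)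
    LinearlyIndependent {k} v =
      (c : Vector R.Carrier k) → linearCombination c v ≈ᴹ 0ᴹ → ∀ i → c i R.≈ R.0#

    Spanning : ∀ {k} → Vector Carrierᴹ k → Set (r ⊔ m ⊔ ℓm)
    Spanning {k} v = ∀ x → ∃ λ (c : Vector R.Carrier k) → x ≈ᴹ linearCombination c v

    record IsBasis {k} (v : Vector Carrierᴹ k) : Set (r ⊔ ℓr ⊔ m ⊔ ℓm) where
      field
        linearlyIndependent : LinearlyIndependent v
        spanning            : Spanning v

    HasDimension : ℕ → Set (r ⊔ ℓr ⊔ m ⊔ ℓm)
    HasDimension k = ∃ λ (v : Vector Carrierᴹ k) → IsBasis v

    sumOver : ∀ {a} {A : Set a} → List A → (A → Carrierᴹ) → Carrierᴹ
    sumOver xs f = sum {length xs} (f ∘ List.lookup xs)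

    *ₗ-distrib-sum : ∀ {k} c (v : Vector Carrierᴹ k) → c *ₗ sum v ≈ᴹ sum (λ i → c *ₗ v i)
    *ₗ-distrib-sum {zero}  c v = *ₗ-zeroʳ c
    *ₗ-distrib-sum {suc k} c v =
      ≈ᴹ-trans (*ₗ-distribˡ c _ _) (+ᴹ-cong ≈ᴹ-refl (*ₗ-distrib-sum c (v ∘ suc)))

  record IsSubmodule {m ℓm p} (M : Module R m ℓm) (P : Module.Carrierᴹ M → Set p)
                     : Set (r ⊔ m ⊔ p) where
    open Module M
    field
      add-closed   : ∀ {x y} → P x → P y → P (x +ᴹ y)
      zero-closed  : P 0ᴹ
      scale-closed : ∀ c {x} → P x → P (c *ₗ x)
      neg-closed   : ∀ {x} → P x → P (-ᴹ x)

    sum-closed : ∀ {k} {v : Vector Carrierᴹ k} → (∀ i → P (v i)) →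
                 P (Sum.sum +ᴹ-commutativeMonoid v)
    sum-closed {zero}  Pv = zero-closed
    sum-closed {suc k} Pv = add-closed (Pv zero) (sum-closed (Pv ∘ suc))

  submodule : ∀ {m ℓm p} (M : Module R m ℓm) {P : Module.Carrierᴹ M → Set p} →
              IsSubmodule M P → Module R (m ⊔ p) ℓm
  submodule M {P} sub = record
    { Carrierᴹ = ∃ P
    ; _≈ᴹ_     = λ x y → proj₁ x ≈ᴹ proj₁ y
    ; _+ᴹ_     = λ (x , Px) (y , Py) → x +ᴹ y , add-closed Px Py
    ; _*ₗ_     = λ c (x , Px) → c *ₗ x , scale-closed c Px
    ; _*ᵣ_     = λ (x , Px) c → c *ₗ x , scale-closed c Px
    ; 0ᴹ       = 0ᴹ , zero-closed
    ; -ᴹ_      = λ (x , Px) → -ᴹ x , neg-closed Px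
    ; isModule = IsModuleFromLeft.isModule {commutativeRing = R} (record { isLeftModule = record
      { isLeftSemimodule = record
        { +ᴹ-isCommutativeMonoid = record
          { isMonoid = record
            { isSemigroup = record
              { isMagma = record
                { isEquivalence = record
                  { refl = ≈ᴹ-refl ; sym = ≈ᴹ-sym ; trans = ≈ᴹ-trans }
                ; ∙-cong = +ᴹ-cong }
              ; assoc = λ _ _ _ → +ᴹ-assoc _ _ _ }
            ; identity = (λ _ → +ᴹ-identityˡ _) , (λ _ → +ᴹ-identityʳ _) }
          ; comm = λ _ _ → +ᴹ-comm _ _ }
        ; isPreleftSemimodule = record
          { *ₗ-cong      = *ₗ-cong
          ; *ₗ-zeroˡ     = λ _ → *ₗ-zeroˡ _
          ; *ₗ-distribʳ  = λ _ _ _ → *ₗ-distribʳ _ _ _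
          ; *ₗ-identityˡ = λ _ → *ₗ-identityˡ _
          ; *ₗ-assoc     = λ _ _ _ → *ₗ-assoc _ _ _
          ; *ₗ-zeroʳ     = λ _ → *ₗ-zeroʳ _
          ; *ₗ-distribˡ  = λ _ _ _ → *ₗ-distribˡ _ _ _ } }
      ; -ᴹ‿cong    = -ᴹ‿cong
      ; -ᴹ‿inverse = (λ _ → -ᴹ‿inverseˡ _) , (λ _ → -ᴹ‿inverseʳ _) } })
    }
    where
    open Module M
    open IsSubmodule sub

  record LinearMap {m ℓm n ℓn} (M : Module R m ℓm) (N : Module R n ℓn)
                   : Set (r ⊔ m ⊔ n ⊔ ℓm ⊔ ℓn) where
    field
      to : Module.Carrierᴹ M → Module.Carrierᴹ N
      isModuleHomomorphism : IsModuleHomomorphism (Module.rawModule M) (Module.rawModule N) to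

    open IsModuleHomomorphism isModuleHomomorphism public

  module _ {m ℓm n ℓn} {M : Module R m ℓm} {N : Module R n ℓn} where
    private
      module M = Module M
      module N = Module N

    linearMap : (f : M.Carrierᴹ → N.Carrierᴹ) →
                (∀ {x y} → x M.≈ᴹ y → f x N.≈ᴹ f y) →
                (∀ x y → f (x M.+ᴹ y) N.≈ᴹ f x N.+ᴹ f y) →
                (∀ c x → f (c M.*ₗ x) N.≈ᴹ c N.*ₗ f x) →
                LinearMap M N
    linearMap f f-cong f-+ f-* = record
      { to = f
      ; isModuleHomomorphism = record { isBimoduleHomomorphism = record
        { +ᴹ-isGroupHomomorphism = record
          { isMonoidHomomorphism = record
            { isMagmaHomomorphism = record
              { isRelHomomorphism = record { cong = f-cong }
              ; homo = f-+ }
            ; ε-homo = f-0 }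
          ; ⁻¹-homo = λ x → N.uniqueʳ‿-ᴹ (f x) (f (M.-ᴹ x))
              (N.≈ᴹ-trans (N.≈ᴹ-sym (f-+ x (M.-ᴹ x))) (N.≈ᴹ-trans (f-cong (M.-ᴹ‿inverseʳ x)) f-0)) }
        ; *ₗ-homo = f-*
        ; *ᵣ-homo = λ c x →
            N.≈ᴹ-trans (f-cong (M.≈ᴹ-sym (M.*ₗ-*ᵣ-coincident c x)))
              (N.≈ᴹ-trans (f-* c x) (N.*ₗ-*ᵣ-coincident c (f x))) } }
      }
      where
      f-0 : f M.0ᴹ N.≈ᴹ N.0ᴹ
      f-0 = N.≈ᴹ-trans (f-cong (M.≈ᴹ-sym (M.*ₗ-zeroˡ M.0ᴹ)))
              (N.≈ᴹ-trans (f-* R.0# M.0ᴹ) (N.*ₗ-zeroˡ (f M.0ᴹ)))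

    image : LinearMap M N → Module R (m ⊔ n ⊔ ℓn) ℓn
    image f = submodule N {λ y → ∃ λ x → to x N.≈ᴹ y} record
      { add-closed   = λ (x , fx) (y , fy) → x M.+ᴹ y , N.≈ᴹ-trans (+ᴹ-homo x y) (N.+ᴹ-cong fx fy)
      ; zero-closed  = M.0ᴹ , 0ᴹ-homo
      ; scale-closed = λ c (x , fx) → c M.*ₗ x , N.≈ᴹ-trans (*ₗ-homo c x) (N.*ₗ-cong R.refl fx)
      ; neg-closed   = λ (x , fx) → M.-ᴹ x , N.≈ᴹ-trans (-ᴹ-homo x) (N.-ᴹ‿cong fx)
      }
      where open LinearMap f

    HasRank : LinearMap M N → ℕ → Set (r ⊔ ℓr ⊔ m ⊔ n ⊔ ℓn)
    HasRank f = HasDimension (image f)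

multiIndices : ∀ n → ℕ → List (Vec ℕ n)
multiIndices zero    zero    = [] ∷ []
multiIndices zero    (suc d) = []
multiIndices (suc n) d       =
  concatMap (λ i → List.map (i ∷_) (multiIndices n (d ∸ i))) (upTo (suc d))

∈-multiIndices⁻ : ∀ n d {α} → α ∈ multiIndices n d → Vec.sum α ≡ d
∈-multiIndices⁻ zero    zero {[]} _ = ≡.refl
∈-multiIndices⁻ (suc n) d α∈
  with i , i∈ , α∈ᵢ ← find (∈.∈-concatMap⁻
         (λ i → List.map (i ∷_) (multiIndices n (d ∸ i))) {upTo (suc d)} α∈)
  with β , β∈ , ≡.refl ← ∈.∈-map⁻ (i ∷_) α∈ᵢ
  = ≡.trans (≡.cong (i +_) (∈-multiIndices⁻ n (d ∸ i) β∈)) (ℕ.m+[n∸m]≡n (s≤s⁻¹ (∈-upTo⁻ i∈)))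

∈-multiIndices⁺ : ∀ {n} (α : Vec ℕ n) → α ∈ multiIndices n (Vec.sum α)
∈-multiIndices⁺ []      = here ≡.refl
∈-multiIndices⁺ (i ∷ α) = ∈.∈-concatMap⁺ (λ j → List.map (j ∷_) (multiIndices _ (i + Vec.sum α ∸ j)))
  (lose (∈-upTo⁺ (s≤s (ℕ.m≤m+n i _)))
    (∈.∈-map⁺ (i ∷_)
      (≡.subst (λ e → α ∈ multiIndices _ e) (≡.sym (ℕ.m+n∸m≡n i _)) (∈-multiIndices⁺ α))))

multiIndices-unique : ∀ n d → Unique (multiIndices n d)
multiIndices-unique zero    zero    = [] ∷ []
multiIndices-unique zero    (suc d) = []
multiIndices-unique (suc n) d       = Unique.concat⁺
  (All.map⁺ (All.universal (λ i → Unique.map⁺ Vec.∷-injectiveʳ (multiIndices-unique n (d ∸ i)))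
                           (upTo (suc d))))
  (AllPairs.map⁺ (AllPairs.map disjoint (Unique.upTo⁺ (suc d))))
  where
  disjoint : ∀ {i j} → i ≢ j → Disjoint (List.map (i ∷_) (multiIndices n (d ∸ i)))
                                        (List.map (j ∷_) (multiIndices n (d ∸ j)))
  disjoint {i} {j} i≢j (∈i , ∈j)
    with _ , _ , ≡.refl ← ∈.∈-map⁻ (i ∷_) ∈i
    with _ , _ , eq     ← ∈.∈-map⁻ (j ∷_) ∈j
    = i≢j (Vec.∷-injectiveˡ eq)

sum-[]%=suc : ∀ {n} (α : Vec ℕ n) i → Vec.sum (α [ i ]%= suc) ≡ suc (Vec.sum α)
sum-[]%=suc (a ∷ α) zero    = ≡.refl
sum-[]%=suc (a ∷ α) (suc i) = ≡.trans (≡.cong (a +_) (sum-[]%=suc α i)) (ℕ.+-suc a _)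

sum-allFin : ∀ {n} (α : Vec ℕ n) → List.sum (List.map (lookup α) (allFin n)) ≡ Vec.sum α
sum-allFin []      = ≡.refl
sum-allFin (a ∷ α) = ≡.cong (a +_) (≡.trans
  (≡.cong List.sum (≡.trans (List.map-tabulate suc (lookup (a ∷ α)))
                            (≡.sym (List.map-tabulate id (lookup α)))))
  (sum-allFin α))

module Polynomials {c ℓ} (R : CommutativeRing c ℓ) where

  private
    module R = CommutativeRing R

  open R using (Carrier; _≈_; 0#; 1#)
  open RawMonoidDefs R.+-rawMonoid using (_×_)
  open LinearAlgebra R

  -- Formal power series in n variables: a series is the family of its
  -- coefficients, p α being the coefficient of x₁^α₁ ⋯ xₙ^αₙ.
  Series : ℕ → Module R c ℓ
  Series n = record
    { Carrierᴹ = Vec ℕ n → Carrier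
    ; _≈ᴹ_     = λ p q → ∀ α → p α ≈ q α
    ; _+ᴹ_     = λ p q α → p α R.+ q α
    ; _*ₗ_     = λ a p α → a R.* p α
    ; _*ᵣ_     = λ p a α → a R.* p α
    ; 0ᴹ       = λ _ → 0#
    ; -ᴹ_      = λ p α → R.- p α
    ; isModule = IsModuleFromLeft.isModule {commutativeRing = R} (record { isLeftModule = record
      { isLeftSemimodule = record
        { +ᴹ-isCommutativeMonoid = Pointwise.isCommutativeMonoid (Vec ℕ n) R.+-isCommutativeMonoid
        ; isPreleftSemimodule = record
          { *ₗ-cong      = λ a≈b p≈q α → R.*-cong a≈b (p≈q α)
          ; *ₗ-zeroˡ     = λ p α → R.zeroˡ (p α)
          ; *ₗ-distribʳ  = λ p a b α → R.distribʳ (p α) a b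
          ; *ₗ-identityˡ = λ p α → R.*-identityˡ (p α)
          ; *ₗ-assoc     = λ a b p α → R.*-assoc a b (p α)
          ; *ₗ-zeroʳ     = λ a α → R.zeroʳ a
          ; *ₗ-distribˡ  = λ a p q α → R.distribˡ a (p α) (q α) } }
      ; -ᴹ‿cong    = λ p≈q α → R.-‿cong (p≈q α)
      ; -ᴹ‿inverse = (λ p α → R.-‿inverseˡ (p α)) , (λ p α → R.-‿inverseʳ (p α)) } })
    }

  IsHomogeneous : ∀ {n} → ℕ → (Vec ℕ n → Carrier) → Set ℓ
  IsHomogeneous d p = ∀ α → Vec.sum α ≢ d → p α ≈ 0#

  homogeneous-isSubmodule : ∀ n d → IsSubmodule (Series n) (IsHomogeneous d)
  homogeneous-isSubmodule n d = record
    { add-closed   = λ Hp Hq α ≢d → R.trans (R.+-cong (Hp α ≢d) (Hq α ≢d)) (R.+-identityˡ 0#)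
    ; zero-closed  = λ _ _ → R.refl
    ; scale-closed = λ a Hp α ≢d → R.trans (R.*-cong R.refl (Hp α ≢d)) (R.zeroʳ a)
    ; neg-closed   = λ Hp α ≢d → R.trans (R.-‿cong (Hp α ≢d)) -0#≈0#
    }
    where open RingProperties R.ring using (-0#≈0#)

  -- S^d: since only finitely many multi-indices have sum d, a homogeneous
  -- series is a polynomial.
  HomPoly : ℕ → ℕ → Module R (c ⊔ ℓ) ℓ
  HomPoly n d = submodule (Series n) (homogeneous-isSubmodule n d)

  -- (S^e)^*: the operator Σ_{|α|=e} D_α ∂^α is given by its coefficients D_α,
  -- i.e. by a form of degree e in ∂₁, …, ∂ₙ.
  DiffOp : ℕ → ℕ → Module R (c ⊔ ℓ) ℓ
  DiffOp = HomPoly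

  -- The coefficient of x^α in ∂p/∂xᵢ is (αᵢ + 1) p_{α+eᵢ}.
  ∂ : ∀ {n} → Fin n → (Vec ℕ n → Carrier) → (Vec ℕ n → Carrier)
  ∂ i p α = suc (lookup α i) × p (α [ i ]%= suc)

  ∂^ : ∀ {n} → Vec ℕ n → (Vec ℕ n → Carrier) → (Vec ℕ n → Carrier)
  ∂^ {n} α p = List.foldr (λ i q → fold q (∂ i) (lookup α i)) p (allFin n)

  apply : ∀ {n} e → (Vec ℕ n → Carrier) → (Vec ℕ n → Carrier) → (Vec ℕ n → Carrier)
  apply {n} e D p = sumOver (Series n) (multiIndices n e) (λ α → D α *ₗ ∂^ α p)
    where open Module (Series n)

  ∂-homogeneous : ∀ {n d} i {p : Vec ℕ n → Carrier} →
                  IsHomogeneous d p → IsHomogeneous (pred d) (∂ i p)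
  ∂-homogeneous {d = d} i {p} Hp α ≢d = R.trans
    (Mult.×-congʳ R.+-monoid (suc (lookup α i)) (Hp (α [ i ]%= suc) λ eq →
      ≢d (≡.cong pred (≡.trans (≡.sym (sum-[]%=suc α i)) eq))))
    (×-zero (suc (lookup α i)))
    where
    ×-zero : ∀ k → k × 0# ≈ 0#
    ×-zero zero    = R.refl
    ×-zero (suc k) = R.trans (R.+-identityˡ _) (×-zero k)

  ∂^-homogeneous : ∀ {n d} α {p : Vec ℕ n → Carrier} →
                   IsHomogeneous d p → IsHomogeneous (d ∸ Vec.sum α) (∂^ α p)
  ∂^-homogeneous {n} {d} α {p} Hp =
    ≡.subst (λ s → IsHomogeneous (d ∸ s) (∂^ α p)) (sum-allFin α) (go (allFin n))
    where
    power : ∀ {e} i {q : Vec ℕ n → Carrier} k →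
            IsHomogeneous e q → IsHomogeneous (e ∸ k) (fold q (∂ i) k)
    power     i     zero    Hq = Hq
    power {e} i {q} (suc k) Hq =
      ≡.subst (λ s → IsHomogeneous s (fold q (∂ i) (suc k)))
              (ℕ.pred[m∸n]≡m∸[1+n] e k) (∂-homogeneous i (power i k Hq))

    go : ∀ is → IsHomogeneous (d ∸ List.sum (List.map (lookup α) is))
                              (List.foldr (λ i q → fold q (∂ i) (lookup α i)) p is)
    go []       = Hp
    go (i ∷ is) = ≡.subst
      (λ s → IsHomogeneous s (List.foldr (λ i q → fold q (∂ i) (lookup α i)) p (i ∷ is)))
      (≡.trans (ℕ.∸-+-assoc d (List.sum (List.map (lookup α) is)) (lookup α i))
               (≡.cong (d ∸_) (ℕ.+-comm (List.sum (List.map (lookup α) is)) (lookup α i))))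
      (power i (lookup α i) (go is))

  apply-homogeneous : ∀ {n d} e D {p : Vec ℕ n → Carrier} →
                      IsHomogeneous d p → IsHomogeneous (d ∸ e) (apply e D p)
  apply-homogeneous {n} {d} e D {p} Hp = sum-closed λ j →
    scale-closed (D (List.lookup (multiIndices n e) j))
      (≡.subst (λ s → IsHomogeneous (d ∸ s) (∂^ (List.lookup (multiIndices n e) j) p))
        (∈-multiIndices⁻ n e (∈-lookup j))
        (∂^-homogeneous (List.lookup (multiIndices n e) j) Hp))
    where open IsSubmodule (homogeneous-isSubmodule n (d ∸ e))

  -- p_{e,d-e} : D ↦ D(p).  For e > d the target is S^0 and the map is zero.
  flattening : ∀ {n d} → Module.Carrierᴹ (HomPoly n d) → ∀ e →
               LinearMap (DiffOp n e) (HomPoly n (d ∸ e))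
  flattening {n} {d} (p , Hp) e = linearMap
    (λ (D , _) → apply e D p , apply-homogeneous e D Hp)
    (λ D≈E → sum-cong-≋ λ j → *ₗ-cong (D≈E (idx j)) ≈ᴹ-refl)
    (λ (D , _) (E , _) → ≈ᴹ-trans
      (sum-cong-≋ λ j → *ₗ-distribʳ (∂^ (idx j) p) (D (idx j)) (E (idx j)))
      (∑-distrib-+ (λ j → D (idx j) *ₗ ∂^ (idx j) p) (λ j → E (idx j) *ₗ ∂^ (idx j) p)))
    (λ a (D , _) → ≈ᴹ-trans (sum-cong-≋ λ j → *ₗ-assoc a (D (idx j)) (∂^ (idx j) p))
      (≈ᴹ-sym (*ₗ-distrib-sum (Series n) a (λ j → D (idx j) *ₗ ∂^ (idx j) p))))
    where
    open Module (Series n)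
    open Sum +ᴹ-commutativeMonoid using (sum-cong-≋; ∑-distrib-+)
    idx = List.lookup (multiIndices n e)

  monomial : ∀ {n} → Vec ℕ n → (Vec ℕ n → Carrier)
  monomial α β = if does (Vec.≡-dec _≟_ α β) then 1# else 0#

  monomial-homogeneous : ∀ {n} (α : Vec ℕ n) → IsHomogeneous (Vec.sum α) (monomial α)
  monomial-homogeneous α β ≢d with Vec.≡-dec _≟_ α β
  ... | yes ≡.refl = ⊥-elim (≢d ≡.refl)
  ... | no  _      = R.refl

  completeSymmetric : ∀ n d → Module.Carrierᴹ (HomPoly n d)
  completeSymmetric n d = sumOver (Series n) (multiIndices n d) monomial ,
    IsSubmodule.sum-closed (homogeneous-isSubmodule n d) λ j →
      ≡.subst (λ s → IsHomogeneous s (monomial (List.lookup (multiIndices n d) j)))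
        (∈-multiIndices⁻ n d (∈-lookup j))
        (monomial-homogeneous (List.lookup (multiIndices n d) j))

fieldRing : ∀ {c ℓ₁ ℓ₂} → HeytingField c ℓ₁ ℓ₂ → CommutativeRing c ℓ₁
fieldRing K = HeytingCommutativeRing.commutativeRing (HeytingField.heytingCommutativeRing K)

-- Positive integers are apart from zero, i.e. invertible; classically # is ≉
-- and this is the usual condition.  ℂ is a Heyting field satisfying it.
CharacteristicZero : ∀ {c ℓ₁ ℓ₂} → HeytingField c ℓ₁ ℓ₂ → Set ℓ₂
CharacteristicZero K = ∀ n → suc n × 1# # 0#
  where
  open HeytingField K
  open RawMonoidDefs (CommutativeRing.+-rawMonoid (fieldRing K)) using (_×_)

{-# OPTIONS --safe #-}

-- Write |β| = d − e.  The coefficient of x^β in ∂^α h is R_α(β) = (α+β)!/β!, and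
--   Σᵢ R_{α+eᵢ}(β) = (n + |α| + |β|) R_α(β),
--   βᵢ R_α(β) = R_{α+eᵢ}(β) − (αᵢ + 1) R_α(β).
-- Hence, for n > 0, the span V_k of the functions R_α, |α| = k, on {|β| = d − e} grows with k and
-- βᵢ V_k ⊆ V_{k+1}.  Since V₀ contains the constants, V_{d−e} contains the falling
-- factorials β ↦ Πᵢ βᵢ(βᵢ−1)⋯(βᵢ−γᵢ+1) with |γ| = d − e, and these vanish except at γ.
-- So the flattening is surjective when d − e ≤ e, and, the matrix (α+β)! being
-- symmetric, injective when e ≤ d − e.
module Submission where

open import Defs
open import Algebra.Apartness.Bundles using (HeytingField)
open import Algebra.Bundles using (CommutativeRing)
open import Algebra.Module.Bundles using (Module)
import Algebra.Properties.Ring as RingProperties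
import Algebra.Properties.CommutativeMonoid.Sum as Sum
import Algebra.Properties.CommutativeSemigroup as CommutativeSemigroupProperties
import Algebra.Properties.Semiring.Mult as SemiringMult
import Algebra.Properties.Semiring.Sum as SemiringSum
open import Data.Empty using (⊥-elim)
open import Data.Fin.Base using (Fin; zero; suc; punchIn)
open import Data.Fin.Properties using (punchInᵢ≢i)
open import Data.List.Base as List using (List; []; _∷_; length; allFin; concatMap; applyUpTo)
open import Data.List.Membership.Propositional.Properties using (∈-lookup)
import Data.List.Properties as List
import Data.List.Relation.Unary.All as All
open import Data.List.Relation.Unary.AllPairs using ([]; _∷_)
open import Data.List.Relation.Unary.Any using (index)
open import Data.List.Relation.Unary.Any.Properties using (lookup-index)
open import Data.List.Relation.Unary.Unique.Propositional using (Unique)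
open import Data.Nat.Base using
  (ℕ; zero; suc; _+_; _*_; _∸_; _⊓_; _≤_; _<_; _≤′_; ≤′-reflexive; ≤′-step; z≤n; s≤s)
open import Data.Nat.GeneralisedArithmetic using (fold)
open import Data.Nat.Properties as ℕ using (_≟_)
open import Data.Nat.Tactic.RingSolver using (solve-∀)
open import Data.Product.Base using (∃; ∃₂; _×_; _,_; proj₁; proj₂)
open import Data.Sum.Base using (_⊎_; inj₁; inj₂)
open import Data.Vec.Base as Vec using (Vec; []; _∷_; lookup; _[_]%=_)
open import Data.Vec.Functional using (Vector)
import Data.Vec.Properties as Vec
open import Function.Base using (_∘_; id)
open import Level using (_⊔_)
import Relation.Binary.Reasoning.Setoid as SetoidReasoning
open import Relation.Binary.PropositionalEquality as ≡ using (_≡_; _≢_; cong; cong₂; subst)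
open import Relation.Nullary.Decidable using (yes; no)

lookup-injective : ∀ {a} {A : Set a} {xs : List A} → Unique xs →
                   ∀ {i j} → List.lookup xs i ≡ List.lookup xs j → i ≡ j
lookup-injective (_  ∷ _) {zero}  {zero}  _  = ≡.refl
lookup-injective (x∉ ∷ _) {zero}  {suc j} eq = ⊥-elim (All.lookup x∉ (∈-lookup j) eq)
lookup-injective (x∉ ∷ _) {suc i} {zero}  eq = ⊥-elim (All.lookup x∉ (∈-lookup i) (≡.sym eq))
lookup-injective (_  ∷ u) {suc i} {suc j} eq = cong suc (lookup-injective u eq)

length-concatMap-applyUpTo :
  ∀ {a b} {A : Set a} {B : Set b} (F G : A → List B) (f g : ℕ → A) →
  (∀ i → length (F (f i)) ≡ length (G (g i))) →
  ∀ k → length (concatMap F (applyUpTo f k)) ≡ length (concatMap G (applyUpTo g k))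
length-concatMap-applyUpTo F G f g eq zero    = ≡.refl
length-concatMap-applyUpTo F G f g eq (suc k) = ≡.trans (List.length-++ (F (f 0)))
  (≡.trans (cong₂ _+_ (eq 0) (length-concatMap-applyUpTo F G (f ∘ suc) (g ∘ suc) (eq ∘ suc) k))
    (≡.sym (List.length-++ (G (g 0)))))

length-multiIndices-suc : ∀ n d → length (multiIndices (suc n) (suc d)) ≡
                          length (multiIndices n (suc d)) + length (multiIndices (suc n) d)
length-multiIndices-suc n d = ≡.trans (List.length-++ (List.map (0 ∷_) (multiIndices n (suc d))))
  (cong₂ _+_ (List.length-map (0 ∷_) (multiIndices n (suc d)))
    (length-concatMap-applyUpTo
      (λ i → List.map (i ∷_) (multiIndices n (suc d ∸ i)))
      (λ i → List.map (i ∷_) (multiIndices n (d ∸ i)))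
      suc id
      (λ i → ≡.trans (List.length-map (suc i ∷_) (multiIndices n (d ∸ i)))
                     (≡.sym (List.length-map (i ∷_) (multiIndices n (d ∸ i)))))
      (suc d)))

length-multiIndices-mono : ∀ n {d e} → d ≤′ e →
                           length (multiIndices (suc n) d) ≤ length (multiIndices (suc n) e)
length-multiIndices-mono n (≤′-reflexive ≡.refl) = ℕ.≤-refl
length-multiIndices-mono n {e = suc e} (≤′-step d≤e) = begin
  _                                                                 ≤⟨ length-multiIndices-mono n d≤e ⟩
  length (multiIndices (suc n) e)                                   ≤⟨ ℕ.m≤n+m _ _ ⟩
  length (multiIndices n (suc e)) + length (multiIndices (suc n) e) ≡⟨ length-multiIndices-suc n e ⟨
  length (multiIndices (suc n) (suc e))                             ∎
  where open ℕ.≤-Reasoning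

infix 8 _↓_ _↓ᵛ_
infixl 9 _⊕_

_↓_ : ℕ → ℕ → ℕ
n     ↓ zero  = 1
zero  ↓ suc k = 0
suc n ↓ suc k = suc n * (n ↓ k)

*-↓ : ∀ n k → n * (n ↓ k) ≡ n ↓ suc k + k * (n ↓ k)
*-↓ zero    zero    = ≡.refl
*-↓ zero    (suc k) = ≡.sym (ℕ.*-zeroʳ k)
*-↓ (suc n) zero    = ≡.sym (ℕ.+-identityʳ _)
*-↓ (suc n) (suc k) = begin
  suc n * (suc n * (n ↓ k))                              ≡⟨ lemma₁ n (n ↓ k) ⟩
  suc n * (n * (n ↓ k)) + suc n * (n ↓ k)                ≡⟨ cong (λ x → suc n * x + suc n * (n ↓ k)) (*-↓ n k) ⟩
  suc n * (n ↓ suc k + k * (n ↓ k)) + suc n * (n ↓ k)    ≡⟨ lemma₂ n k (n ↓ suc k) (n ↓ k) ⟩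
  suc n * (n ↓ suc k) + suc k * (suc n * (n ↓ k))        ∎
  where
  open ≡.≡-Reasoning
  lemma₁ : ∀ n a → suc n * (suc n * a) ≡ suc n * (n * a) + suc n * a
  lemma₁ = solve-∀
  lemma₂ : ∀ n k b a → suc n * (b + k * a) + suc n * a ≡ suc n * b + suc k * (suc n * a)
  lemma₂ = solve-∀

[m+n]↓m*n↓n : ∀ m n → (m + n) ↓ m * n ↓ n ≡ (m + n) ↓ (m + n)
[m+n]↓m*n↓n zero    n = ℕ.*-identityˡ _
[m+n]↓m*n↓n (suc m) n =
  ≡.trans (ℕ.*-assoc (suc (m + n)) ((m + n) ↓ m) (n ↓ n)) (cong (suc (m + n) *_) ([m+n]↓m*n↓n m n))

suc[m+n]↓m*suc[n] : ∀ m n → suc (m + n) ↓ m * suc n ≡ suc (m + n) * ((m + n) ↓ m)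
suc[m+n]↓m*suc[n] zero    n = ℕ.*-comm 1 (suc n)
suc[m+n]↓m*suc[n] (suc m) n = ≡.trans (ℕ.*-assoc (suc (suc (m + n))) (suc (m + n) ↓ m) (suc n))
  (cong (suc (suc (m + n)) *_) (suc[m+n]↓m*suc[n] m n))

n↓n>0 : ∀ n → 0 < n ↓ n
n↓n>0 zero    = s≤s z≤n
n↓n>0 (suc n) = ℕ.*-mono-≤ {1} {suc n} (s≤s z≤n) (n↓n>0 n)

n<k⇒n↓k≡0 : ∀ {n k} → n < k → n ↓ k ≡ 0
n<k⇒n↓k≡0 {zero}  (s≤s _)   = ≡.refl
n<k⇒n↓k≡0 {suc n} (s≤s n<k) = ≡.trans (cong (suc n *_) (n<k⇒n↓k≡0 n<k)) (ℕ.*-zeroʳ n)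

_⊕_ : ∀ {n} → Vec ℕ n → Vec ℕ n → Vec ℕ n
_⊕_ = Vec.zipWith _+_

⊕-comm : ∀ {n} (α β : Vec ℕ n) → α ⊕ β ≡ β ⊕ α
⊕-comm = Vec.zipWith-comm ℕ.+-comm

sum-⊕ : ∀ {n} (α β : Vec ℕ n) → Vec.sum (α ⊕ β) ≡ Vec.sum α + Vec.sum β
sum-⊕ []      []      = ≡.refl
sum-⊕ (a ∷ α) (b ∷ β) = ≡.trans (cong (a + b +_) (sum-⊕ α β)) (lemma a b _ _)
  where
  lemma : ∀ a b A B → a + b + (A + B) ≡ a + A + (b + B)
  lemma = solve-∀

_↓ᵛ_ : ∀ {n} → Vec ℕ n → Vec ℕ n → ℕ
[]      ↓ᵛ []      = 1
(b ∷ β) ↓ᵛ (a ∷ α) = b ↓ a * β ↓ᵛ α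

[α⊕β]↓ᵛα*β↓ᵛβ : ∀ {n} (α β : Vec ℕ n) → (α ⊕ β) ↓ᵛ α * β ↓ᵛ β ≡ (α ⊕ β) ↓ᵛ (α ⊕ β)
[α⊕β]↓ᵛα*β↓ᵛβ []      []      = ≡.refl
[α⊕β]↓ᵛα*β↓ᵛβ (a ∷ α) (b ∷ β) = ≡.trans (ℕ.[m*n]*[o*p]≡[m*o]*[n*p] ((a + b) ↓ a) ((α ⊕ β) ↓ᵛ α) (b ↓ b) (β ↓ᵛ β))
  (cong₂ _*_ ([m+n]↓m*n↓n a b) ([α⊕β]↓ᵛα*β↓ᵛβ α β))

-- Both sides are α! β! R_α(β) = α! (α+β)!.
↓ᵛ-symmetric : ∀ {n} (α β : Vec ℕ n) →
               (β ⊕ α) ↓ᵛ β * α ↓ᵛ α ≡ (α ⊕ β) ↓ᵛ α * β ↓ᵛ β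
↓ᵛ-symmetric α β = ≡.trans ([α⊕β]↓ᵛα*β↓ᵛβ β α)
  (≡.trans (cong (λ γ → γ ↓ᵛ γ) (⊕-comm β α)) (≡.sym ([α⊕β]↓ᵛα*β↓ᵛβ α β)))

α↓ᵛα>0 : ∀ {n} (α : Vec ℕ n) → 0 < α ↓ᵛ α
α↓ᵛα>0 []      = s≤s z≤n
α↓ᵛα>0 (a ∷ α) = ℕ.*-mono-≤ (n↓n>0 a) (α↓ᵛα>0 α)

↓ᵛ-≡0 : ∀ {n} (β γ : Vec ℕ n) → Vec.sum β ≤ Vec.sum γ → β ≢ γ → β ↓ᵛ γ ≡ 0
↓ᵛ-≡0 []      []      _  β≢γ = ⊥-elim (β≢γ ≡.refl)
↓ᵛ-≡0 (b ∷ β) (c ∷ γ) ≤Σ β≢γ with ℕ.<-≤-connex b c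
... | inj₁ b<c = cong (_* β ↓ᵛ γ) (n<k⇒n↓k≡0 b<c)
... | inj₂ c≤b with Vec.≡-dec _≟_ β γ
...   | yes ≡.refl = ⊥-elim (β≢γ (cong (_∷ β) (ℕ.≤-antisym (ℕ.+-cancelʳ-≤ (Vec.sum β) b c ≤Σ) c≤b)))
...   | no  β≢γ′   = ≡.trans (cong (b ↓ c *_) (↓ᵛ-≡0 β γ Σβ≤Σγ β≢γ′)) (ℕ.*-zeroʳ (b ↓ c))
  where
  Σβ≤Σγ : Vec.sum β ≤ Vec.sum γ
  Σβ≤Σγ = ℕ.+-cancelˡ-≤ c _ _ (ℕ.≤-trans (ℕ.+-monoˡ-≤ (Vec.sum β) c≤b) ≤Σ)

↓ᵛ-sum≡0 : ∀ {n} (β γ : Vec ℕ n) → Vec.sum γ ≡ 0 → β ↓ᵛ γ ≡ 1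
↓ᵛ-sum≡0 []      []         _  = ≡.refl
↓ᵛ-sum≡0 (b ∷ β) (zero ∷ γ) eq = ≡.trans (ℕ.*-identityˡ _) (↓ᵛ-sum≡0 β γ eq)

⊕-↓ᵛ-suc : ∀ {n} (α β : Vec ℕ n) i →
           ((α [ i ]%= suc) ⊕ β) ↓ᵛ (α [ i ]%= suc) ≡
           suc (lookup α i + lookup β i) * (α ⊕ β) ↓ᵛ α
⊕-↓ᵛ-suc (a ∷ α) (b ∷ β) zero    = ℕ.*-assoc (suc (a + b)) ((a + b) ↓ a) ((α ⊕ β) ↓ᵛ α)
⊕-↓ᵛ-suc (a ∷ α) (b ∷ β) (suc i) =
  ≡.trans (cong ((a + b) ↓ a *_) (⊕-↓ᵛ-suc α β i)) (x∙yz≈y∙xz ((a + b) ↓ a) (suc (lookup α i + lookup β i)) ((α ⊕ β) ↓ᵛ α))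
  where open CommutativeSemigroupProperties ℕ.*-commutativeSemigroup

*-↓ᵛ : ∀ {n} (β γ : Vec ℕ n) i →
       lookup β i * β ↓ᵛ γ ≡ β ↓ᵛ (γ [ i ]%= suc) + lookup γ i * β ↓ᵛ γ
*-↓ᵛ (b ∷ β) (c ∷ γ) zero    = begin
  b * (b ↓ c * x)                  ≡⟨ ℕ.*-assoc b (b ↓ c) x ⟨
  b * (b ↓ c) * x                  ≡⟨ cong (_* x) (*-↓ b c) ⟩
  (b ↓ suc c + c * (b ↓ c)) * x    ≡⟨ lemma (b ↓ suc c) c (b ↓ c) x ⟩
  b ↓ suc c * x + c * (b ↓ c * x)  ∎
  where
  open ≡.≡-Reasoning
  x = β ↓ᵛ γ
  lemma : ∀ y c z x → (y + c * z) * x ≡ y * x + c * (z * x)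
  lemma = solve-∀
*-↓ᵛ (b ∷ β) (c ∷ γ) (suc i) = begin
  βᵢ * (y * x)                                ≡⟨ x∙yz≈y∙xz βᵢ y x ⟩
  y * (βᵢ * x)                                ≡⟨ cong (y *_) (*-↓ᵛ β γ i) ⟩
  y * (β ↓ᵛ (γ [ i ]%= suc) + γᵢ * x)         ≡⟨ lemma y (β ↓ᵛ (γ [ i ]%= suc)) γᵢ x ⟩
  y * β ↓ᵛ (γ [ i ]%= suc) + γᵢ * (y * x)     ∎
  where
  open ≡.≡-Reasoning
  open CommutativeSemigroupProperties ℕ.*-commutativeSemigroup
  x  = β ↓ᵛ γ
  y  = b ↓ c
  βᵢ = lookup β i
  γᵢ = lookup γ i
  lemma : ∀ y z c x → y * (z + c * x) ≡ y * z + c * (y * x)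
  lemma = solve-∀

sum≡suc : ∀ {n k} (γ : Vec ℕ n) → Vec.sum γ ≡ suc k → ∃₂ λ δ i → δ [ i ]%= suc ≡ γ
sum≡suc (suc c ∷ γ) _  = c ∷ γ , zero , ≡.refl
sum≡suc (zero  ∷ γ) eq with δ , i , ≡.refl ← sum≡suc γ eq = zero ∷ δ , suc i , ≡.refl

module Rank {r ℓr} {R : CommutativeRing r ℓr} where
  open LinearAlgebra R

  private
    module R = CommutativeRing R

  module _ {m ℓm n ℓn} {M : Module R m ℓm} {N : Module R n ℓn} (f : LinearMap M N) where
    private
      module M = Module M
      module N = Module N
    open LinearMap f

    image-linearCombination : ∀ {k} (c : Vector R.Carrier k) v →
      proj₁ (linearCombination (image f) c v) ≡ linearCombination N c (proj₁ ∘ v)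
    image-linearCombination {zero}  c v = ≡.refl
    image-linearCombination {suc k} c v =
      cong (c zero N.*ₗ proj₁ (v zero) N.+ᴹ_) (image-linearCombination (c ∘ suc) (v ∘ suc))

    map-linearCombination : ∀ {k} (c : Vector R.Carrier k) v →
      to (linearCombination M c v) N.≈ᴹ linearCombination N c (to ∘ v)
    map-linearCombination {zero}  c v = 0ᴹ-homo
    map-linearCombination {suc k} c v = N.≈ᴹ-trans (+ᴹ-homo _ _)
      (N.+ᴹ-cong (*ₗ-homo _ _) (map-linearCombination (c ∘ suc) (v ∘ suc)))

    surjective⇒rank : (∀ y → ∃ λ x → to x N.≈ᴹ y) → ∀ {k} → HasDimension N k → HasRank f k
    surjective⇒rank surj (v , basis) = w , record
      { linearlyIndependent = λ c eq → linearlyIndependent c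
          (N.≈ᴹ-trans (N.≈ᴹ-reflexive (≡.sym (image-linearCombination c w))) eq)
      ; spanning = λ (y , _) → let c , eq = spanning y in
          c , N.≈ᴹ-trans eq (N.≈ᴹ-reflexive (≡.sym (image-linearCombination c w)))
      }
      where
      open IsBasis basis
      w : Vector (Module.Carrierᴹ (image f)) _
      w i = v i , surj (v i)

    injective⇒rank : (∀ x → to x N.≈ᴹ N.0ᴹ → x M.≈ᴹ M.0ᴹ) →
                     ∀ {k} → HasDimension M k → HasRank f k
    injective⇒rank inj (v , basis) = w , record
      { linearlyIndependent = λ c eq → linearlyIndependent c (inj _ (N.≈ᴹ-trans (image-of c) eq))
      ; spanning = λ (y , x , fx≈y) → let c , eq = spanning x in
          c , N.≈ᴹ-trans (N.≈ᴹ-sym fx≈y) (N.≈ᴹ-trans (⟦⟧-cong eq) (image-of c))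
      }
      where
      open IsBasis basis
      w : Vector (Module.Carrierᴹ (image f)) _
      w i = to (v i) , v i , N.≈ᴹ-refl
      image-of : ∀ c → to (linearCombination M c v) N.≈ᴹ proj₁ (linearCombination (image f) c w)
      image-of c = N.≈ᴹ-trans (map-linearCombination c v)
                     (N.≈ᴹ-reflexive (≡.sym (image-linearCombination c w)))

module CompleteSymmetricFlattening {c ℓ} (R : CommutativeRing c ℓ) where
  private
    module R = CommutativeRing R
  open R using (Carrier; _≈_; 0#; 1#; +-cong; +-congˡ; +-congʳ; *-congˡ; *-congʳ)
  open LinearAlgebra R
  open Polynomials R
  open Rank {R = R}
  open SemiringMult R.semiring
    using (×-congʳ; ×-assocˡ; ×-homo-1; ×-homo-+; ×1-homo-*) renaming (_×_ to _·_)
  open SemiringSum R.semiring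
    using (sum; sum-cong-≋; sum-remove; sum-replicate-zero; ∑-distrib-+; *-distribˡ-sum; *-distribʳ-sum)
  open RingProperties R.ring using (-‿distribˡ-*)
  open CommutativeSemigroupProperties R.*-commutativeSemigroup
    using () renaming (x∙yz≈y∙xz to x*[y*z]≈y*[x*z])

  ⟦_⟧ : ℕ → Carrier
  ⟦ k ⟧ = k · 1#

  ⟦⟧-reflexive : ∀ {j k} → j ≡ k → ⟦ j ⟧ ≈ ⟦ k ⟧
  ⟦⟧-reflexive ≡.refl = R.refl

  sum-≈0 : ∀ {k} {t : Vector Carrier k} → (∀ i → t i ≈ 0#) → sum t ≈ 0#
  sum-≈0 {k} t≈0 = R.trans (sum-cong-≋ t≈0) (sum-replicate-zero k)

  sum-single : ∀ {k} (t : Vector Carrier k) i → (∀ j → j ≢ i → t j ≈ 0#) → sum t ≈ t i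
  sum-single {suc k} t i t≈0 = R.trans (sum-remove {i = i} t)
    (R.trans (+-congˡ (sum-≈0 λ j → t≈0 (punchIn i j) (punchInᵢ≢i i j))) (R.+-identityʳ _))

  series-sum : ∀ {n k} (v : Vector (Vec ℕ n → Carrier) k) β →
               Sum.sum (Module.+ᴹ-commutativeMonoid (Series n)) v β ≡ sum (λ i → v i β)
  series-sum {k = zero}  v β = ≡.refl
  series-sum {k = suc k} v β = cong (v zero β R.+_) (series-sum (v ∘ suc) β)

  hom-linearCombination : ∀ {n d k} (a : Vector Carrier k) (v : Vector (Module.Carrierᴹ (HomPoly n d)) k) β →
    proj₁ (linearCombination (HomPoly n d) a v) β ≡ sum (λ i → a i R.* proj₁ (v i) β)
  hom-linearCombination {k = zero}  a v β = ≡.refl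
  hom-linearCombination {k = suc k} a v β =
    cong (a zero R.* proj₁ (v zero) β R.+_) (hom-linearCombination (a ∘ suc) (v ∘ suc) β)

  homogeneous-≈ : ∀ {n d} {p q : Vec ℕ n → Carrier} → IsHomogeneous d p → IsHomogeneous d q →
                  (∀ β → Vec.sum β ≡ d → p β ≈ q β) → ∀ β → p β ≈ q β
  homogeneous-≈ {d = d} Hp Hq eq β with Vec.sum β ≟ d
  ... | yes ≡d = eq β ≡d
  ... | no  ≢d = R.trans (Hp β ≢d) (R.sym (Hq β ≢d))

  monomial-≡ : ∀ {n} (α : Vec ℕ n) → monomial α α ≈ 1#
  monomial-≡ α with Vec.≡-dec _≟_ α α
  ... | yes _   = R.refl
  ... | no  α≢α = ⊥-elim (α≢α ≡.refl)

  monomial-≢ : ∀ {n} {α β : Vec ℕ n} → α ≢ β → monomial α β ≈ 0#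
  monomial-≢ {α = α} {β} α≢β with Vec.≡-dec _≟_ α β
  ... | yes α≡β = ⊥-elim (α≢β α≡β)
  ... | no  _   = R.refl

  module _ (n d : ℕ) where

    multiIndex : Fin (length (multiIndices n d)) → Vec ℕ n
    multiIndex = List.lookup (multiIndices n d)

    sum-multiIndex : ∀ i → Vec.sum (multiIndex i) ≡ d
    sum-multiIndex i = ∈-multiIndices⁻ n d (∈-lookup i)

    multiIndex-injective : ∀ {i j} → multiIndex i ≡ multiIndex j → i ≡ j
    multiIndex-injective = lookup-injective (multiIndices-unique n d)

    multiIndex-surjective : ∀ β → Vec.sum β ≡ d → ∃ λ i → β ≡ multiIndex i
    multiIndex-surjective β ≡.refl = index (∈-multiIndices⁺ β) , lookup-index (∈-multiIndices⁺ β)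

    sum-monomials : ∀ (t : Vector Carrier (length (multiIndices n d))) i →
                    sum (λ j → t j R.* monomial (multiIndex j) (multiIndex i)) ≈ t i
    sum-monomials t i = R.trans
      (sum-single _ i λ j j≢i → R.trans (*-congˡ (monomial-≢ (j≢i ∘ multiIndex-injective))) (R.zeroʳ _))
      (R.trans (*-congˡ (monomial-≡ (multiIndex i))) (R.*-identityʳ _))

    homPoly-dimension : HasDimension (HomPoly n d) (length (multiIndices n d))
    homPoly-dimension = v , record
      { linearlyIndependent = λ a eq i → R.trans
          (R.sym (sum-monomials a i))
          (R.trans (R.reflexive (≡.sym (hom-linearCombination a v (multiIndex i)))) (eq (multiIndex i)))
      ; spanning = λ (p , Hp) → p ∘ multiIndex ,
          homogeneous-≈ Hp (proj₂ (linearCombination (HomPoly n d) (p ∘ multiIndex) v)) λ β ≡d →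
            let i , β≡ = multiIndex-surjective β ≡d in
            subst (λ β → p β ≈ proj₁ (linearCombination (HomPoly n d) (p ∘ multiIndex) v) β) (≡.sym β≡)
              (R.trans (R.sym (sum-monomials (p ∘ multiIndex) i))
                (R.reflexive (≡.sym (hom-linearCombination (p ∘ multiIndex) v (multiIndex i)))))
      }
      where
      v : Vector (Module.Carrierᴹ (HomPoly n d)) _
      v i = monomial (multiIndex i) ,
            subst (λ s → IsHomogeneous s (monomial (multiIndex i))) (sum-multiIndex i)
                  (monomial-homogeneous (multiIndex i))

    completeSymmetric-coefficient : ∀ β → Vec.sum β ≡ d → proj₁ (completeSymmetric n d) β ≈ 1#
    completeSymmetric-coefficient β ≡d with i , ≡.refl ← multiIndex-surjective β ≡d =
      R.trans (R.reflexive (series-sum (monomial ∘ multiIndex) (multiIndex i)))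
        (R.trans (sum-single _ i λ j j≢i → monomial-≢ (j≢i ∘ multiIndex-injective))
          (monomial-≡ (multiIndex i)))

  ∂-zero-power : ∀ {n} a (q : Vec ℕ (suc n) → Carrier) b β →
                 fold q (∂ zero) a (b ∷ β) ≈ ((a + b) ↓ a) · q (a + b ∷ β)
  ∂-zero-power zero    q b β = R.sym (×-homo-1 _)
  ∂-zero-power (suc a) q b β = begin
    suc b · fold q (∂ zero) a (suc b ∷ β)              ≈⟨ ×-congʳ (suc b) (∂-zero-power a q (suc b) β) ⟩
    suc b · (((a + suc b) ↓ a) · q (a + suc b ∷ β))    ≡⟨ cong (λ s → suc b · ((s ↓ a) · q (s ∷ β))) (ℕ.+-suc a b) ⟩
    suc b · ((suc (a + b) ↓ a) · q (suc (a + b) ∷ β))  ≈⟨ ×-assocˡ _ (suc b) (suc (a + b) ↓ a) ⟩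
    (suc b * (suc (a + b) ↓ a)) · q (suc (a + b) ∷ β)  ≡⟨ cong (_· q (suc (a + b) ∷ β))
      (≡.trans (ℕ.*-comm (suc b) (suc (a + b) ↓ a)) (suc[m+n]↓m*suc[n] a b)) ⟩
    (suc (a + b) ↓ suc a) · q (suc (a + b) ∷ β)        ∎
    where open SetoidReasoning R.setoid

  ∂-suc-power : ∀ {n} i k {q : Vec ℕ (suc n) → Carrier} {b} {q′ : Vec ℕ n → Carrier} →
                (∀ β → q (b ∷ β) ≡ q′ β) →
                ∀ β → fold q (∂ (suc i)) k (b ∷ β) ≡ fold q′ (∂ i) k β
  ∂-suc-power i zero    eq β = eq β
  ∂-suc-power i (suc k) eq β = cong (suc (lookup β i) ·_) (∂-suc-power i k eq (β [ i ]%= suc))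

  ∂^-coefficient : ∀ {n} (α : Vec ℕ n) p β → ∂^ α p β ≈ ((α ⊕ β) ↓ᵛ α) · p (α ⊕ β)
  ∂^-coefficient []      p []      = R.sym (×-homo-1 _)
  ∂^-coefficient {suc n} (a ∷ α) p (b ∷ β) = begin
    fold q (∂ zero) a (b ∷ β)                               ≈⟨ ∂-zero-power a q b β ⟩
    ((a + b) ↓ a) · q (a + b ∷ β)                           ≡⟨ cong (((a + b) ↓ a) ·_) (q≡ β) ⟩
    ((a + b) ↓ a) · ∂^ α p′ β                               ≈⟨ ×-congʳ ((a + b) ↓ a) (∂^-coefficient α p′ β) ⟩
    ((a + b) ↓ a) · (((α ⊕ β) ↓ᵛ α) · p′ (α ⊕ β))           ≈⟨ ×-assocˡ _ ((a + b) ↓ a) ((α ⊕ β) ↓ᵛ α) ⟩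
    ((a + b) ↓ a * (α ⊕ β) ↓ᵛ α) · p′ (α ⊕ β)               ∎
    where
    open SetoidReasoning R.setoid
    p′ : Vec ℕ n → Carrier
    p′ = p ∘ (a + b ∷_)
    q : Vec ℕ (suc n) → Carrier
    q = List.foldr (λ i q → fold q (∂ i) (lookup (a ∷ α) i)) p (List.tabulate suc)
    shift : ∀ is β → List.foldr (λ i q → fold q (∂ i) (lookup (a ∷ α) i)) p (List.map suc is) (a + b ∷ β)
                   ≡ List.foldr (λ i q → fold q (∂ i) (lookup α i)) p′ is β
    shift []       β = ≡.refl
    shift (i ∷ is) β = ∂-suc-power i (lookup α i) (shift is) β
    q≡ : ∀ β → q (a + b ∷ β) ≡ ∂^ α p′ β
    q≡ β = ≡.trans
      (cong (λ is → List.foldr (λ i q → fold q (∂ i) (lookup (a ∷ α) i)) p is (a + b ∷ β))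
            (≡.sym (List.map-tabulate id suc)))
      (shift (allFin n) β)

  -- R_α = rising α.
  rising : ∀ {n} → Vec ℕ n → Vec ℕ n → Carrier
  rising α β = ⟦ (α ⊕ β) ↓ᵛ α ⟧

  falling : ∀ {n} → Vec ℕ n → Vec ℕ n → Carrier
  falling γ β = ⟦ β ↓ᵛ γ ⟧

  apply-coefficient : ∀ {n d e} D (β : Vec ℕ n) → e + Vec.sum β ≡ d →
    apply e D (proj₁ (completeSymmetric n d)) β ≈
    sum (λ i → D (multiIndex n e i) R.* rising (multiIndex n e i) β)
  apply-coefficient {n} {d} {e} D β ≡d =
    R.trans (R.reflexive (series-sum (λ i α → D (idx i) R.* ∂^ (idx i) h α) β))
      (sum-cong-≋ λ i → *-congˡ (R.trans (∂^-coefficient (idx i) h β)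
        (×-congʳ ((idx i ⊕ β) ↓ᵛ idx i) (completeSymmetric-coefficient n d (idx i ⊕ β)
          (≡.trans (sum-⊕ (idx i) β) (≡.trans (cong (_+ Vec.sum β) (sum-multiIndex n e i)) ≡d))))))
    where
    idx = multiIndex n e
    h   = proj₁ (completeSymmetric n d)

  data RisingSpan {n} (f k : ℕ) : (Vec ℕ n → Carrier) → Set (c ⊔ ℓ) where
    generator : ∀ α → Vec.sum α ≡ k → RisingSpan f k (rising α)
    zero      : RisingSpan f k (λ _ → 0#)
    add       : ∀ {g g′} → RisingSpan f k g → RisingSpan f k g′ →
                RisingSpan f k (λ β → g β R.+ g′ β)
    scale     : ∀ a {g} → RisingSpan f k g → RisingSpan f k (λ β → a R.* g β)
    resp      : ∀ {g g′} → (∀ β → Vec.sum β ≡ f → g β ≈ g′ β) →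
                RisingSpan f k g → RisingSpan f k g′

  span-sum : ∀ {n f k m} {g : Fin m → Vec ℕ n → Carrier} → (∀ i → RisingSpan f k (g i)) →
             RisingSpan f k (λ β → sum (λ i → g i β))
  span-sum {m = zero}  gs = zero
  span-sum {m = suc m} gs = add (gs zero) (span-sum (gs ∘ suc))

  sum-suc-lookup : ∀ {n} (α β : Vec ℕ n) →
    sum (λ i → ⟦ suc (lookup α i + lookup β i) ⟧) ≈ ⟦ n + (Vec.sum α + Vec.sum β) ⟧
  sum-suc-lookup []      []      = R.refl
  sum-suc-lookup {suc n} (a ∷ α) (b ∷ β) = R.trans (+-congˡ (sum-suc-lookup α β))
    (R.trans (R.sym (×-homo-+ 1# (suc (a + b)) _)) (⟦⟧-reflexive (lemma a b n (Vec.sum α) (Vec.sum β))))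
    where
    lemma : ∀ a b n A B → suc (a + b) + (n + (A + B)) ≡ suc n + (a + A + (b + B))
    lemma = solve-∀

  rising-suc : ∀ {n} (α β : Vec ℕ n) i →
               rising (α [ i ]%= suc) β ≈ ⟦ suc (lookup α i + lookup β i) ⟧ R.* rising α β
  rising-suc α β i = R.trans (⟦⟧-reflexive (⊕-↓ᵛ-suc α β i)) (×1-homo-* (suc (lookup α i + lookup β i)) ((α ⊕ β) ↓ᵛ α))

  x+y-x : ∀ x y z → (x R.+ y) R.* z R.+ (R.- x) R.* z ≈ y R.* z
  x+y-x x y z = begin
    (x R.+ y) R.* z R.+ (R.- x) R.* z ≈⟨ R.distribʳ z (x R.+ y) (R.- x) ⟨
    (x R.+ y R.+ R.- x) R.* z         ≈⟨ *-congʳ (+-congʳ (R.+-comm x y)) ⟩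
    (y R.+ x R.+ R.- x) R.* z         ≈⟨ *-congʳ (R.+-assoc y x (R.- x)) ⟩
    (y R.+ (x R.+ R.- x)) R.* z       ≈⟨ *-congʳ (+-congˡ (R.-‿inverseʳ x)) ⟩
    (y R.+ 0#) R.* z                  ≈⟨ *-congʳ (R.+-identityʳ y) ⟩
    y R.* z                           ∎
    where open SetoidReasoning R.setoid

  sum-falling : ∀ {n e} (t : Vec ℕ n → Carrier) i →
    sum (λ j → t (multiIndex n e j) R.* falling (multiIndex n e i) (multiIndex n e j)) ≈
    t (multiIndex n e i) R.* falling (multiIndex n e i) (multiIndex n e i)
  sum-falling {n} {e} t i = sum-single _ i λ j j≢i → R.trans
    (*-congˡ (⟦⟧-reflexive (↓ᵛ-≡0 (multiIndex n e j) (multiIndex n e i)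
      (ℕ.≤-reflexive (≡.trans (sum-multiIndex n e j) (≡.sym (sum-multiIndex n e i))))
      (j≢i ∘ multiIndex-injective n e))))
    (R.zeroʳ _)

  module _ (invert : ∀ k → ∃ λ x → x R.* ⟦ suc k ⟧ ≈ 1#) where

    raise : ∀ {n f k} {g : Vec ℕ (suc n) → Carrier} → RisingSpan f k g → RisingSpan f (suc k) g
    raise {n} {f} {k} (generator α ≡k) =
      let x , x*N≈1 = invert (n + (k + f)) in
      resp
        (λ β ≡f → begin
          x R.* sum (λ i → rising (α [ i ]%= suc) β)
            ≈⟨ *-congˡ (sum-cong-≋ (rising-suc α β)) ⟩
          x R.* sum (λ i → ⟦ suc (lookup α i + lookup β i) ⟧ R.* rising α β)
            ≈⟨ *-congˡ (*-distribʳ-sum (rising α β) (λ i → ⟦ suc (lookup α i + lookup β i) ⟧)) ⟨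
          x R.* (sum (λ i → ⟦ suc (lookup α i + lookup β i) ⟧) R.* rising α β)
            ≈⟨ *-congˡ (*-congʳ (sum-suc-lookup α β)) ⟩
          x R.* (⟦ suc n + (Vec.sum α + Vec.sum β) ⟧ R.* rising α β)
            ≈⟨ R.*-assoc x _ _ ⟨
          x R.* ⟦ suc n + (Vec.sum α + Vec.sum β) ⟧ R.* rising α β
            ≡⟨ cong₂ (λ A B → x R.* ⟦ suc n + (A + B) ⟧ R.* rising α β) ≡k ≡f ⟩
          x R.* ⟦ suc n + (k + f) ⟧ R.* rising α β
            ≈⟨ *-congʳ x*N≈1 ⟩
          1# R.* rising α β
            ≈⟨ R.*-identityˡ _ ⟩
          rising α β ∎)
        (scale x (span-sum λ i → generator (α [ i ]%= suc) (≡.trans (sum-[]%=suc α i) (cong suc ≡k))))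
      where open SetoidReasoning R.setoid
    raise zero          = zero
    raise (add s s′)    = add (raise s) (raise s′)
    raise (scale a s)   = scale a (raise s)
    raise (resp eq s)   = resp eq (raise s)

    raise-≤′ : ∀ {n f k l} {g : Vec ℕ (suc n) → Carrier} → k ≤′ l → RisingSpan f k g → RisingSpan f l g
    raise-≤′ (≤′-reflexive ≡.refl) s = s
    raise-≤′ (≤′-step k≤l)         s = raise (raise-≤′ k≤l s)

    multiply : ∀ {n f k} {g : Vec ℕ (suc n) → Carrier} i → RisingSpan f k g →
               RisingSpan f (suc k) (λ β → ⟦ lookup β i ⟧ R.* g β)
    multiply i (generator α ≡k) = resp
      (λ β _ → R.trans
        (+-congʳ (R.trans (rising-suc α β i) (*-congʳ (×-homo-+ 1# (suc (lookup α i)) (lookup β i)))))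
        (x+y-x ⟦ suc (lookup α i) ⟧ ⟦ lookup β i ⟧ (rising α β)))
      (add (generator (α [ i ]%= suc) (≡.trans (sum-[]%=suc α i) (cong suc ≡k)))
           (scale (R.- ⟦ suc (lookup α i) ⟧) (raise (generator α ≡k))))
    multiply i zero        = resp (λ _ _ → R.sym (R.zeroʳ _)) zero
    multiply i (add s s′)  = resp (λ _ _ → R.sym (R.distribˡ _ _ _)) (add (multiply i s) (multiply i s′))
    multiply i (scale a s) = resp (λ _ _ → x*[y*z]≈y*[x*z] a _ _) (scale a (multiply i s))
    multiply i (resp eq s) = resp (λ β ≡f → *-congˡ (eq β ≡f)) (multiply i s)

    falling-span : ∀ {n f} k (γ : Vec ℕ n) → Vec.sum γ ≡ k → RisingSpan f k (falling γ)
    falling-span zero γ ≡0 = resp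
      (λ β _ → ⟦⟧-reflexive (≡.trans (↓ᵛ-sum≡0 (γ ⊕ β) γ ≡0) (≡.sym (↓ᵛ-sum≡0 β γ ≡0))))
      (generator γ ≡0)
    falling-span {zero}  (suc k) [] ()
    falling-span {suc n} (suc k) γ ≡k with δ , i , ≡.refl ← sum≡suc γ ≡k = resp
      (λ β _ → begin
        ⟦ lookup β i ⟧ R.* falling δ β R.+ (R.- ⟦ lookup δ i ⟧) R.* falling δ β
          ≈⟨ +-cong (×1-homo-* (lookup β i) _) (-‿distribˡ-* _ _) ⟨
        ⟦ lookup β i * β ↓ᵛ δ ⟧ R.+ R.- (⟦ lookup δ i ⟧ R.* falling δ β)
          ≈⟨ +-cong (⟦⟧-reflexive (*-↓ᵛ β δ i)) (R.-‿cong (R.sym (×1-homo-* (lookup δ i) _))) ⟩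
        ⟦ β ↓ᵛ (δ [ i ]%= suc) + lookup δ i * β ↓ᵛ δ ⟧ R.+ R.- ⟦ lookup δ i * β ↓ᵛ δ ⟧
          ≈⟨ +-congʳ (×-homo-+ 1# (β ↓ᵛ (δ [ i ]%= suc)) _) ⟩
        falling (δ [ i ]%= suc) β R.+ ⟦ lookup δ i * β ↓ᵛ δ ⟧ R.+ R.- ⟦ lookup δ i * β ↓ᵛ δ ⟧
          ≈⟨ R.+-assoc _ _ _ ⟩
        falling (δ [ i ]%= suc) β R.+ (⟦ lookup δ i * β ↓ᵛ δ ⟧ R.+ R.- ⟦ lookup δ i * β ↓ᵛ δ ⟧)
          ≈⟨ +-congˡ (R.-‿inverseʳ _) ⟩
        falling (δ [ i ]%= suc) β R.+ 0#
          ≈⟨ R.+-identityʳ _ ⟩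
        falling (δ [ i ]%= suc) β ∎)
      (add (multiply i δ-span) (scale (R.- ⟦ lookup δ i ⟧) (raise δ-span)))
      where
      open SetoidReasoning R.setoid
      δ-span = falling-span k δ (ℕ.suc-injective (≡.trans (≡.sym (sum-[]%=suc δ i)) ≡k))

    Dominates : ℕ → ℕ → ℕ → Set (c ⊔ ℓ)
    Dominates n f e = (∀ (γ : Vec ℕ n) → Vec.sum γ ≡ f → RisingSpan f e (falling γ)) ×
                      length (multiIndices n f) ≤ length (multiIndices n e)

    dominates-total : ∀ n f e → Dominates n f e ⊎ Dominates n e f
    dominates-total zero    zero    zero    = inj₁ (falling-span 0 , ℕ.≤-refl)
    dominates-total zero    (suc f) e       = inj₁ ((λ { [] () }) , z≤n)
    dominates-total zero    zero    (suc e) = inj₂ ((λ { [] () }) , z≤n)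
    dominates-total (suc n) f e with ℕ.≤-total f e
    ... | inj₁ f≤e = inj₁ ((λ γ ≡f → raise-≤′ (ℕ.≤⇒≤′ f≤e) (falling-span f γ ≡f)) ,
                           length-multiIndices-mono n (ℕ.≤⇒≤′ f≤e))
    ... | inj₂ e≤f = inj₂ ((λ γ ≡e → raise-≤′ (ℕ.≤⇒≤′ e≤f) (falling-span e γ ≡e)) ,
                           length-multiIndices-mono n (ℕ.≤⇒≤′ e≤f))

    invert-falling : ∀ {n} (γ : Vec ℕ n) → ∃ λ x → x R.* falling γ γ ≈ 1#
    invert-falling γ with γ ↓ᵛ γ | α↓ᵛα>0 γ
    ... | suc k | _ = invert k

    module _ (n d e : ℕ) (e≤d : e ≤ d) where
      private
        f = d ∸ e
        h = completeSymmetric n d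
      open LinearMap (flattening h e)

      realise : ∀ {g} → RisingSpan f e g → ∃ λ D → ∀ β → Vec.sum β ≡ f → proj₁ (to D) β ≈ g β
      realise (generator α ≡e) with i , ≡.refl ← multiIndex-surjective n e α ≡e =
        (monomial α , subst (λ s → IsHomogeneous s (monomial α)) ≡e (monomial-homogeneous α)) ,
        λ β ≡f → R.trans
          (apply-coefficient (monomial α) β (≡.trans (cong (e +_) ≡f) (ℕ.m+[n∸m]≡n e≤d)))
          (R.trans
            (sum-single _ i λ j j≢i → R.trans
              (*-congʳ (monomial-≢ (j≢i ∘ ≡.sym ∘ multiIndex-injective n e))) (R.zeroˡ _))
            (R.trans (*-congʳ (monomial-≡ α)) (R.*-identityˡ _)))
      realise zero = Module.0ᴹ (DiffOp n e) , λ β _ → 0ᴹ-homo β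
      realise (add s s′) =
        let D , D≈ = realise s ; D′ , D′≈ = realise s′ in
        Module._+ᴹ_ (DiffOp n e) D D′ ,
        λ β ≡f → R.trans (+ᴹ-homo D D′ β) (+-cong (D≈ β ≡f) (D′≈ β ≡f))
      realise (scale a s) =
        let D , D≈ = realise s in
        Module._*ₗ_ (DiffOp n e) a D , λ β ≡f → R.trans (*ₗ-homo a D β) (*-congˡ (D≈ β ≡f))
      realise (resp eq s) =
        let D , D≈ = realise s in D , λ β ≡f → R.trans (D≈ β ≡f) (eq β ≡f)

      flattening-surjective : (∀ γ → Vec.sum γ ≡ f → RisingSpan f e (falling γ)) →
                              ∀ q → ∃ λ D → Module._≈ᴹ_ (HomPoly n f) (to D) q
      flattening-surjective spans (q , Hq) =
        let D , D≈ = realise (span-sum λ j →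
              scale (t j) (spans (idx j) (sum-multiIndex n f j)))
        in D , homogeneous-≈ (proj₂ (to D)) Hq λ β ≡f → R.trans (D≈ β ≡f) (interpolate β ≡f)
        where
        idx = multiIndex n f
        t : Vector Carrier _
        t j = q (idx j) R.* proj₁ (invert-falling (idx j))
        interpolate : ∀ β → Vec.sum β ≡ f → sum (λ j → t j R.* falling (idx j) β) ≈ q β
        interpolate β ≡f with i , ≡.refl ← multiIndex-surjective n f β ≡f = R.trans
          (sum-single _ i λ j j≢i → R.trans
            (*-congˡ (⟦⟧-reflexive (↓ᵛ-≡0 (idx i) (idx j)
              (ℕ.≤-reflexive (≡.trans ≡f (≡.sym (sum-multiIndex n f j))))
              (j≢i ∘ ≡.sym ∘ multiIndex-injective n f))))
            (R.zeroʳ _))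
          (R.trans (R.*-assoc _ _ _)
            (R.trans (*-congˡ (proj₂ (invert-falling (idx i)))) (R.*-identityʳ _)))

      annihilate : ∀ D → Module._≈ᴹ_ (HomPoly n f) (to D) (Module.0ᴹ (HomPoly n f)) →
                   ∀ {g} → RisingSpan e f g →
                   sum (λ i → proj₁ D (multiIndex n e i) R.*
                              falling (multiIndex n e i) (multiIndex n e i) R.*
                              g (multiIndex n e i)) ≈ 0#
      annihilate (D , _) D≈0 = go
        where
        idx = multiIndex n e
        w : Vector Carrier _
        w i = D (idx i) R.* falling (idx i) (idx i)
        go : ∀ {g} → RisingSpan e f g → sum (λ i → w i R.* g (idx i)) ≈ 0#
        go (generator β ≡f) = begin
          sum (λ i → D (idx i) R.* falling (idx i) (idx i) R.* rising β (idx i))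
            ≈⟨ sum-cong-≋ (λ i → symmetric (idx i)) ⟩
          sum (λ i → falling β β R.* (D (idx i) R.* rising (idx i) β))
            ≈⟨ *-distribˡ-sum (falling β β) (λ i → D (idx i) R.* rising (idx i) β) ⟨
          falling β β R.* sum (λ i → D (idx i) R.* rising (idx i) β)
            ≈⟨ *-congˡ (apply-coefficient D β (≡.trans (cong (e +_) ≡f) (ℕ.m+[n∸m]≡n e≤d))) ⟨
          falling β β R.* apply e D (proj₁ h) β
            ≈⟨ *-congˡ (D≈0 β) ⟩
          falling β β R.* 0#
            ≈⟨ R.zeroʳ _ ⟩
          0# ∎
          where
          open SetoidReasoning R.setoid
          symmetric : ∀ α → D α R.* falling α α R.* rising β α ≈ falling β β R.* (D α R.* rising α β)
          symmetric α = begin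
            D α R.* falling α α R.* rising β α           ≈⟨ R.*-assoc _ _ _ ⟩
            D α R.* (falling α α R.* rising β α)         ≈⟨ *-congˡ (R.*-comm _ _) ⟩
            D α R.* (rising β α R.* falling α α)         ≈⟨ *-congˡ (×1-homo-* ((β ⊕ α) ↓ᵛ β) (α ↓ᵛ α)) ⟨
            D α R.* ⟦ (β ⊕ α) ↓ᵛ β * α ↓ᵛ α ⟧            ≈⟨ *-congˡ (⟦⟧-reflexive (↓ᵛ-symmetric α β)) ⟩
            D α R.* ⟦ (α ⊕ β) ↓ᵛ α * β ↓ᵛ β ⟧            ≈⟨ *-congˡ (×1-homo-* ((α ⊕ β) ↓ᵛ α) (β ↓ᵛ β)) ⟩
            D α R.* (rising α β R.* falling β β)         ≈⟨ R.*-assoc _ _ _ ⟨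
            D α R.* rising α β R.* falling β β           ≈⟨ R.*-comm _ _ ⟩
            falling β β R.* (D α R.* rising α β)         ∎
        go zero        = sum-≈0 λ i → R.zeroʳ (w i)
        go (add {g} {g′} s s′) = R.trans (sum-cong-≋ λ i → R.distribˡ (w i) (g (idx i)) (g′ (idx i)))
          (R.trans (∑-distrib-+ (λ i → w i R.* g (idx i)) (λ i → w i R.* g′ (idx i)))
            (R.trans (+-cong (go s) (go s′)) (R.+-identityˡ 0#)))
        go (scale a {g} s) = R.trans (sum-cong-≋ λ i → x*[y*z]≈y*[x*z] (w i) a (g (idx i)))
          (R.trans (R.sym (*-distribˡ-sum a (λ i → w i R.* g (idx i))))
            (R.trans (*-congˡ (go s)) (R.zeroʳ a)))
        go (resp eq s) = R.trans
          (sum-cong-≋ λ i → *-congˡ (R.sym (eq (idx i) (sum-multiIndex n e i)))) (go s)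

      cancel-falling : ∀ (γ : Vec ℕ n) {a} → a R.* falling γ γ ≈ 0# → a ≈ 0#
      cancel-falling γ {a} eq = let x , x*γ≈1 = invert-falling γ in begin
        a                          ≈⟨ R.*-identityʳ a ⟨
        a R.* 1#                   ≈⟨ *-congˡ x*γ≈1 ⟨
        a R.* (x R.* falling γ γ)  ≈⟨ x*[y*z]≈y*[x*z] a x _ ⟩
        x R.* (a R.* falling γ γ)  ≈⟨ *-congˡ eq ⟩
        x R.* 0#                   ≈⟨ R.zeroʳ x ⟩
        0#                         ∎
        where open SetoidReasoning R.setoid

      flattening-injective : (∀ γ → Vec.sum γ ≡ e → RisingSpan e f (falling γ)) →
                             ∀ D → Module._≈ᴹ_ (HomPoly n f) (to D) (Module.0ᴹ (HomPoly n f)) →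
                             Module._≈ᴹ_ (DiffOp n e) D (Module.0ᴹ (DiffOp n e))
      flattening-injective spans (D , HD) D≈0 =
        homogeneous-≈ HD (λ _ _ → R.refl) vanish
        where
        vanish : ∀ γ → Vec.sum γ ≡ e → D γ ≈ 0#
        vanish γ ≡e with i , ≡.refl ← multiIndex-surjective n e γ ≡e =
          cancel-falling γ (cancel-falling γ (R.trans
            (R.sym (sum-falling (λ α → D α R.* falling α α) i))
            (annihilate (D , HD) D≈0 (spans γ ≡e))))

      flattening-rank : HasRank (flattening h e) (length (multiIndices n e) ⊓ length (multiIndices n f))
      flattening-rank with dominates-total n f e
      ... | inj₁ (spans , len≤) = subst (HasRank (flattening h e)) (≡.sym (ℕ.m≥n⇒m⊓n≡n len≤))
              (surjective⇒rank (flattening h e) (flattening-surjective spans) (homPoly-dimension n f))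
      ... | inj₂ (spans , len≤) = subst (HasRank (flattening h e)) (≡.sym (ℕ.m≤n⇒m⊓n≡m len≤))
              (injective⇒rank (flattening h e) (flattening-injective spans) (homPoly-dimension n e))

theorem15 :
    ∀ {c ℓ₁ ℓ₂} (K : HeytingField c ℓ₁ ℓ₂) → CharacteristicZero K →
    let open LinearAlgebra (fieldRing K)
        open Polynomials (fieldRing K)
    in
    (n d e : ℕ) → e ≤ d →
    ∃₂ λ (a b : ℕ) →
      HasDimension (DiffOp n e) a ×
      HasDimension (HomPoly n (d ∸ e)) b ×
      HasRank (flattening (completeSymmetric n d) e) (a ⊓ b)
theorem15 K char0 n d e e≤d =
  length (multiIndices n e) , length (multiIndices n (d ∸ e)) ,
  homPoly-dimension n e , homPoly-dimension n (d ∸ e) , flattening-rank invert n d e e≤d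
  where
  open CompleteSymmetricFlattening (fieldRing K)
  open module K = HeytingField K using (_≈_; 1#; #⇒invertible)
  open CommutativeRing (fieldRing K) using (ring; trans; sym; *-congˡ; +-congˡ; +-identityʳ)
  open RingProperties ring using (-0#≈0#)
  invert : ∀ k → ∃ λ x → x K.* ⟦ suc k ⟧ ≈ 1#
  invert k = let x , x*[k-0]≈1 , _ = #⇒invertible (char0 k) in
    x , trans (*-congˡ (sym (trans (+-congˡ -0#≈0#) (+-identityʳ _)))) x*[k-0]≈1
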